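{- Let $\pi$ be a derivation of a judgment $\Lambda\vdash t:L$, with $\Lambda$ a ground context and $L$ a ground type. Let $m_\pi$ be the number of probabilistic axioms in $\pi$ and $n=|\mathrm{Nm}(\mathrm{Cpts}(\pi))|$ the number of names which appear in the factors of $\mathrm{Cpts}(\pi)$. The cost of inductively computing the semantics of $\pi$ following the structure of the derivation (i.e. by the inductive decoration) is $$\mathcal O(m_\pi\cdot 2^W),$$ where $W\le n$ is the maximal cardinality of any set of names $\mathbb Y$ appearing in the derivation when its judgments are decorated with factors $\psi$ over sets of names $\mathbb Y$ by the inductive decoration.
   Context: **Cost.** Cost is the number of elementary arithmetic operations (multiplications and additions of reals) when factors are stored as tables with one entry per tuple and products and sum outs are computed entrywise from their definitions; a product by the trivial factor $\mathbf 1_\emptyset$ needs no operation. (Thus multiplying $k$ factors costs $\mathcal O(k\cdot 2^w)$, with $w$ the number of names of the result, and summing out any set of names from a factor over $w$ names costs $\mathcal O(2^w)$.) **Terms.** Terms $t,u$ and values $v,w$ (up to $\alpha$-equivalence): $t,u ::= v \mid \mathsf{sample}_d \mid \mathsf{case}\ v\ \mathsf{of}\ \{v_i\Rightarrow \mathsf{sample}_{d_i}\} \mid \mathsf{obs}(x=b) \mid \mathsf{let}\ x=u\ \mathsf{in}\ t \mid \mathsf{letp}\ \langle x,y\rangle=v\ \mathsf{in}\ t \mid t\,v\mid \lambda x.t\mid \mathsf{der}\,v$; $v,w ::= x \mid \langle v,w\rangle \mid\ !t \mid b$; $b::=\mathtt t\mid\mathtt f$; $d$ ranges over probability distributions on $\{\mathtt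 t,\mathtt f\}$. $\mathsf c\langle y_1,\dots,y_n\rangle$ abbreviates $\mathsf{case}\ \langle y_1,\dots,y_n\rangle\ \mathsf{of}\ \{\bar b\Rightarrow\mathsf{sample}_{d_{\bar b}}\}_{\bar b\in\{\mathtt t,\mathtt f\}^n}$. **Intersection types.** Fix a countable set of names $X,Y,Z,\dots$. Atomic types: for each name $X$, the three atoms $X$, $X^{\mathtt t}$, $X^{\mathtt f}$ (the last two are *observed*), all having name $X$; we write $\mathcal X$ (resp. $\mathcal Y_i$) for any atom of name $X$ (resp. $Y_i$). Ground types $K,L::=\mathcal X\mid K\otimes L$; positive types $P,Q::=L\mid[A_1,\dots,A_n]$ (finite multiset, $n\ge0$); types $A,B::=P\mid P\multimap A$. A typing context is a total map from variables to positive types with all but finitely many variables mapped to $[]$; it splits into its ground part $\Lambda$ (variables mapped to ground types) and its multiset part $\Gamma$; $\uplus$ is (pointwise) multiset union. $\mathrm{Nm}(\cdot)$ is the set of names occurring. Rules (premises $\Longrightarrow$ conclusion): - (i-sample) $\Lambda\vdash\mathsf{sample}_d:\mathcal X$ if $X\notin\mathrm{Nm}(\Lambda)$. - (i-cond) $\Lambda,y_1:\mathcal Y_1,\dots,y_n:\mathcal Y_n\vdash\mathsf c\langle y_1,\dots,y_n\rangle:\mathcal X$ if $X\notin\{Y_1,\dots,Y_n\}$ and $X\notin\mathrm{Nm}(\Lambda)$. - (i-obs) $\Lambda,x:X^b\vdash\mathsf{obs}(x=b):X^b$. - (i-var) $\Lambda,x:P\vdash x:P$. - (i-let) $\Lambda,\Gamma_1\vdash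 u:P$ and $\Lambda,\Gamma_2,x:P\vdash t:A$ $\Longrightarrow$ $\Lambda,\Gamma_1\uplus\Gamma_2\vdash\mathsf{let}\ x=u\ \mathsf{in}\ t:A$. - (i-pair) $\Lambda\vdash v:L_1$ and $\Lambda\vdash w:L_2$ $\Longrightarrow$ $\Lambda\vdash\langle v,w\rangle:L_1\otimes L_2$. - (i-letp) $\Lambda\vdash v:L_1\otimes L_2$ and $\Lambda,x:L_1,y:L_2,\Gamma\vdash t:A$ $\Longrightarrow$ $\Lambda,\Gamma\vdash\mathsf{letp}\ \langle x,y\rangle=v\ \mathsf{in}\ t:A$. - (i-abs) $\Lambda,\Gamma,x:P\vdash t:A$ $\Longrightarrow$ $\Lambda,\Gamma\vdash\lambda x.t:P\multimap A$. - (i-app) $\Lambda,\Gamma_1\vdash t:P\multimap A$ and $\Lambda,\Gamma_2\vdash v:P$ $\Longrightarrow$ $\Lambda,\Gamma_1\uplus\Gamma_2\vdash t\,v:A$. - (i-bang) $(\Lambda,\Gamma_i\vdash t:A_i)_{i=1}^n$, $n\ge0$ $\Longrightarrow$ $\Lambda,\biguplus_i\Gamma_i\vdash\,!t:[A_1,\dots,A_n]$. - (i-der) $\Lambda,\Gamma\vdash v:[A]$ $\Longrightarrow$ $\Lambda,\Gamma\vdash\mathsf{der}\,v:A$. Axioms (i-sample), (i-cond) are the *probabilistic axioms*; the name $X$ typing the subject is their *main name*. Conditions that are part of the definition of a derivation: main names are pairwise distinct; and atoms with the same name $X$ occurring in the derivation are all equal (all $X$, or all $X^{\mathtt t}$,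 or all $X^{\mathtt f}$). **Factors.** Given a derivation, $\mathrm{Val}(X)=\{\mathtt t\}$ if $X$ occurs in it as $X^{\mathtt t}$, $\{\mathtt f\}$ if it occurs as $X^{\mathtt f}$, and $\{\mathtt t,\mathtt f\}$ otherwise; $\mathrm{Val}(\mathbb X)=\prod_{X\in\mathbb X}\mathrm{Val}(X)$ for a finite set of names $\mathbb X$; $\bar x|_{\mathbb Y}$ is restriction. A factor over $\mathbb X$ is a function $\phi:\mathrm{Val}(\mathbb X)\to\mathbb R_{\ge0}$; $\mathrm{Nm}(\phi)=\mathbb X$. Sum out: for $\mathbb Z\subseteq\mathbb X$, $(\sum_{\mathbb Z}\phi)(\bar y)=\sum_{\bar z\in\mathrm{Val}(\mathbb Z)}\phi(\bar z\bar y)$, a factor over $\mathbb X-\mathbb Z$. Product: $(\phi_1\odot\phi_2)(\bar z)=\phi_1(\bar z|_{\mathrm{Nm}(\phi_1)})\,\phi_2(\bar z|_{\mathrm{Nm}(\phi_2)})$, a factor over $\mathrm{Nm}(\phi_1)\cup\mathrm{Nm}(\phi_2)$; the empty product is $\mathbf 1_\emptyset$, the factor over $\emptyset$ with value $1$. **Factors of axioms.** To $\Lambda\vdash\mathsf{sample}_d:\mathcal X$ is associated the factor over $\{X\}$ with $\phi(x)=d(x)$; to an (i-cond) axiom $\Lambda,y_1:\mathcal Y_1,\dots,y_n:\mathcal Y_n\vdash\mathsf{case}\ \langle y_1,\dots,y_n\rangle\ \mathsf{of}\ \{\bar b\Rightarrow\mathsf{sample}_{d_{\bar b}}\}_{\bar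 b\in\{\mathtt t,\mathtt f\}^n}:\mathcal X$ is associated the factor over $\mathbb Y\cup\{X\}$, $\mathbb Y=\{Y_1,\dots,Y_n\}$, with $\phi(\bar y\,x)=d_{\langle\bar y|_{Y_1},\dots,\bar y|_{Y_n}\rangle}(x)$. $\mathrm{Cpts}(\pi)$ is the set of factors associated with the probabilistic axioms of $\pi$; $\mathrm{Nm}(\mathrm{Cpts}(\pi))=\bigcup_{\phi\in\mathrm{Cpts}(\pi)}\mathrm{Nm}(\phi)$. **Inductive decoration.** Each judgment of the derivation is decorated with a factor $\psi$ over a set of names $\mathbb Y$, by induction: a probabilistic axiom gets its associated factor; (i-var) and (i-obs) get $\mathbf 1_\emptyset$; (i-pair) gets $\mathbf 1_\emptyset$ (its premises having $\mathbf 1_\emptyset$); (i-letp) gets the factor of the premise typing $t$ (the other premise having $\mathbf 1_\emptyset$); (i-abs) and (i-der) get the factor of their premise; (i-bang) gets $\bigodot_i\psi_i$ over $\bigcup_i\mathbb Y_i$, with $\psi_i$ over $\mathbb Y_i$ the factors of its premises; (i-let) and (i-app), with premises having factors $\psi_1,\psi_2$ over $\mathbb Y_1,\mathbb Y_2$, get $\sum_{\mathbb Z}(\psi_1\odot\psi_2)$ over $(\mathbb Y_1\cup\mathbb Y_2)-\mathbb Z$, with $\mathbb Z=(\mathbb Y_1\cup\mathbb Y_2)-\mathrm{Nm}(\Lambda,\Gamma_1,\Gamma_2,A)$.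
   Formalization: W is taken to range also over the sets Y1∪Y2 of the products formed at i-let and i-app before summing out, not only over the sets decorating judgments; with the latter alone the bound fails, since a product table can have 8^k entries while every judgment has at most 2k names and m = 2k. -}

module Defs where

open import Algebra.Bundles using (CommutativeSemiring)
open import Data.Bool using (Bool; true; false)
open import Data.Fin using (Fin)
open import Data.List as List using (List; []; _∷_; _++_; [_]; length; concatMap; cartesianProductWith; deduplicate; filter; foldr)
open import Data.List.Membership.DecPropositional using (_∈?_)
open import Data.List.Membership.Propositional using (_∈_; _∉_)
open import Data.List.Membership.Propositional.Properties using (∈-deduplicate⁺; ∈-filter⁺; ∈-++⁺ˡ; ∈-++⁺ʳ)
open import Data.List.Relation.Binary.Permutation.Homogeneous using (Permutation)
open import Data.List.Relation.Binary.Permutation.Propositional using (_↭_)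
open import Data.List.Relation.Binary.Subset.Propositional using (_⊆_)
open import Data.List.Relation.Binary.Subset.Propositional.Properties using (filter-⊆)
open import Data.List.Relation.Unary.All as All using (All; []; _∷_)
open import Data.List.Relation.Unary.All.Properties using (anti-mono; ++⁺)
open import Data.List.Relation.Unary.Any using (here; there)
open import Data.List.Relation.Unary.Unique.DecPropositional.Properties using (deduplicate-!)
open import Data.List.Relation.Unary.Unique.Propositional using (Unique)
import Data.List.Relation.Unary.Unique.Propositional.Properties as Unique
open import Data.Maybe using (Maybe; just; nothing)
open import Data.Nat using (ℕ; zero; suc; _⊔_; _≟_) renaming (_+_ to _+ℕ_)
open import Data.Nat.ListAction using (sum)
open import Data.Product using (∃; _×_; _,_; proj₁; proj₂)
open import Data.Vec as Vec using (Vec; []; _∷_)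
open import Data.Vec.Membership.Propositional.Properties using (∈-lookup; ∈-toList⁺)
open import Function using (_∘_)
open import Level using (Level)
open import Relation.Binary.PropositionalEquality using (_≡_; _≢_; refl)
open import Relation.Nullary using (yes; no; ¬?)

Name : Set
Name = ℕ

record NameSet : Set where
  constructor nameSet
  field
    elements : List Name
    unique   : Unique elements

open NameSet public

∣_∣ : NameSet → ℕ
∣ 𝕏 ∣ = length (elements 𝕏)

fromList : List Name → NameSet
fromList xs = nameSet (deduplicate _≟_ xs) (deduplicate-! _≟_ xs)

∅ : NameSet
∅ = fromList []

infixl 6 _∪_ _─_

_∪_ : NameSet → NameSet → NameSet
𝕏 ∪ 𝕐 = fromList (elements 𝕏 ++ elements 𝕐)

_─_ : NameSet → NameSet → NameSet
𝕏 ─ 𝕐 = nameSet (filter (λ x → ¬? (_∈?_ _≟_ x (elements 𝕐))) (elements 𝕏))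
                (Unique.filter⁺ (λ x → ¬? (_∈?_ _≟_ x (elements 𝕐))) (unique 𝕏))

⋃ : List NameSet → NameSet
⋃ = foldr _∪_ ∅

_⊆ₙ_ : NameSet → NameSet → Set
𝕏 ⊆ₙ 𝕐 = elements 𝕏 ⊆ elements 𝕐

─-⊆ : ∀ 𝕏 𝕐 → (𝕏 ─ 𝕐) ⊆ₙ 𝕏
─-⊆ 𝕏 𝕐 = filter-⊆ (λ x → ¬? (_∈?_ _≟_ x (elements 𝕐))) (elements 𝕏)

∪-⊆ˡ : ∀ 𝕏 𝕐 → 𝕏 ⊆ₙ (𝕏 ∪ 𝕐)
∪-⊆ˡ 𝕏 𝕐 = ∈-deduplicate⁺ _≟_ ∘ ∈-++⁺ˡ

∪-⊆ʳ : ∀ 𝕏 𝕐 → 𝕐 ⊆ₙ (𝕏 ∪ 𝕐)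
∪-⊆ʳ 𝕏 𝕐 = ∈-deduplicate⁺ _≟_ ∘ ∈-++⁺ʳ (elements 𝕏)

⊆-split : ∀ 𝕏 ℤ → elements 𝕏 ⊆ (elements ℤ ++ elements (𝕏 ─ ℤ))
⊆-split 𝕏 ℤ {x} x∈𝕏 with _∈?_ _≟_ x (elements ℤ)
... | yes x∈ℤ = ∈-++⁺ˡ x∈ℤ
... | no  x∉ℤ = ∈-++⁺ʳ (elements ℤ) (∈-filter⁺ (λ y → ¬? (_∈?_ _≟_ y (elements ℤ))) x∈𝕏 x∉ℤ)

-- (X , nothing) is the atom X, and (X , just b) is the observed atom Xᵇ.
record Atom : Set where
  constructor atom
  field
    name     : Name
    observed : Maybe Bool

open Atom public

data Ground : Set where
  ‵_  : Atom → Ground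
  _⊗_ : Ground → Ground → Ground

-- A finite multiset is given by a list of its elements in some order.
-- Lists are identified up to order in the two places where it matters:
-- in _≅_ (used by i-var) and in _≣_⊎_ (the splitting of contexts).
mutual
  data Pos : Set where
    ground : Ground → Pos
    mset   : List Type → Pos

  data Type : Set where
    pos : Pos → Type
    _⊸_ : Pos → Type → Type

mutual
  data _≅⁺_ : Pos → Pos → Set where
    ground : ∀ {L} → ground L ≅⁺ ground L
    mset   : ∀ {As Bs} → Permutation _≅_ As Bs → mset As ≅⁺ mset Bs

  data _≅_ : Type → Type → Set where
    pos : ∀ {P Q} → P ≅⁺ Q → pos P ≅ pos Q
    _⊸_ : ∀ {P Q A B} → P ≅⁺ Q → A ≅ B → (P ⊸ A) ≅ (Q ⊸ B)

atomsᴳ : Ground → List Atom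
atomsᴳ (‵ a)     = [ a ]
atomsᴳ (K ⊗ L) = atomsᴳ K ++ atomsᴳ L

mutual
  atomsᴾ : Pos → List Atom
  atomsᴾ (ground L) = atomsᴳ L
  atomsᴾ (mset As)  = atomsᴹ As

  atomsᴹ : List Type → List Atom
  atomsᴹ []       = []
  atomsᴹ (A ∷ As) = atomsᵀ A ++ atomsᴹ As

  atomsᵀ : Type → List Atom
  atomsᵀ (pos P) = atomsᴾ P
  atomsᵀ (P ⊸ A) = atomsᴾ P ++ atomsᵀ A

-- Variables are de Bruijn indices.  A variable outside the scope Fin n is
-- implicitly mapped to [].
Ctx : ℕ → Set
Ctx n = Vec Pos n

atomsᶜ : ∀ {n} → Ctx n → List Atom
atomsᶜ Δ = concatMap atomsᴾ (Vec.toList Δ)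

atomsᴶ : ∀ {n} → Ctx n → Type → List Atom
atomsᴶ Δ A = atomsᶜ Δ ++ atomsᵀ A

Nm : List Atom → NameSet
Nm as = fromList (List.map name as)

data IsGroundPos : Pos → Set where
  ground : ∀ {L} → IsGroundPos (ground L)
  empty  : IsGroundPos (mset [])

-- The multiset part of the context is everywhere [].
IsGround : ∀ {n} → Ctx n → Set
IsGround Δ = ∀ x → IsGroundPos (Vec.lookup Δ x)

groundPart : ∀ {n} → Ctx n → Ctx n
groundPart = Vec.map λ { (ground L) → ground L ; (mset _) → mset [] }

data _≣ᴾ_⊎_ : Pos → Pos → Pos → Set where
  ground : ∀ {L} → ground L ≣ᴾ ground L ⊎ ground L
  mset   : ∀ {As Bs Cs} → As ↭ (Bs ++ Cs) → mset As ≣ᴾ mset Bs ⊎ mset Cs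

-- Δ = Λ,Γ₁⊎Γ₂  with  Δ₁ = Λ,Γ₁  and  Δ₂ = Λ,Γ₂.
_≣_⊎_ : ∀ {n} → Ctx n → Ctx n → Ctx n → Set
Δ ≣ Δ₁ ⊎ Δ₂ = ∀ x → Vec.lookup Δ x ≣ᴾ Vec.lookup Δ₁ x ⊎ Vec.lookup Δ₂ x

bitVectors : ∀ n → List (Vec Bool n)
bitVectors zero    = [ [] ]
bitVectors (suc n) = cartesianProductWith _∷_ (true ∷ false ∷ []) (bitVectors n)

-- nothing: both values are possible; just b: only b is.
Observation : Set
Observation = Name → Maybe Bool

-- The first atom of name X decides; in a derivation all of them agree.
observation : List Atom → Observation
observation []       X = nothing
observation (a ∷ as) X with name a ≟ X
... | yes _ = observed a
... | no  _ = observation as X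

ValOf : Maybe Bool → Set
ValOf nothing  = Bool
ValOf (just b) = ∃ λ b′ → b′ ≡ b

toBool : ∀ o → ValOf o → Bool
toBool nothing  b       = b
toBool (just _) (b , _) = b

allVals : ∀ o → List (ValOf o)
allVals nothing  = true ∷ false ∷ []
allVals (just b) = [ (b , refl) ]

Tuple : Observation → List Name → Set
Tuple ω = All (ValOf ∘ ω)

allTuples : ∀ ω xs → List (Tuple ω xs)
allTuples ω []       = [ [] ]
allTuples ω (x ∷ xs) = cartesianProductWith _∷_ (allVals (ω x)) (allTuples ω xs)

_at_ : ∀ {ω xs x} → Tuple ω xs → x ∈ xs → Bool
_at_ {ω} {x = x} v x∈xs = toBool (ω x) (All.lookup v x∈xs)

_∣[_] : ∀ {ω xs ys} → Tuple ω xs → ys ⊆ xs → Tuple ω ys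
v ∣[ ys⊆xs ] = anti-mono ys⊆xs v

-- R stands for the non-negative reals, of which only the structure of a
-- commutative semiring is used.

module Calculus {c ℓ : Level} (R : CommutativeSemiring c ℓ) where

  open CommutativeSemiring R using (Carrier; _≈_; _+_; _*_; 0#; 1#)

  record Dist : Set (c Level.⊔ ℓ) where
    field
      prob  : Bool → Carrier
      total : prob true + prob false ≈ 1#

  open Dist public

  mutual
    data Term (n : ℕ) : Set (c Level.⊔ ℓ) where
      val     : Value n → Term n
      sample  : Dist → Term n
      case_of_ : Value n → List (Value n × Dist) → Term n
      obs     : Fin n → Bool → Term n
      letin   : Term n → Term (suc n) → Term n
      -- Index 0 is the first component, index 1 the second.
      letp    : Value n → Term (suc (suc n)) → Term n
      _·_     : Term n → Value n → Term n
      ƛ       : Term (suc n) → Term n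
      der     : Value n → Term n

    data Value (n : ℕ) : Set (c Level.⊔ ℓ) where
      var  : Fin n → Value n
      ⟨_,_⟩ : Value n → Value n → Value n
      !_   : Term n → Value n
      bool : Bool → Value n

  -- ⟨v₁,…,vₙ⟩ for n ≥ 1, as nested pairs.
  tuple : ∀ {n k} → Vec (Value n) (suc k) → Value n
  tuple (v ∷ [])     = v
  tuple (v ∷ w ∷ ws) = ⟨ v , tuple (w ∷ ws) ⟩

  cond : ∀ {n k} → Vec (Fin n) (suc k) → (Vec Bool (suc k) → Dist) → Term n
  cond {k = k} ys d =
    case tuple (Vec.map var ys) of
      List.map (λ bs → tuple (Vec.map bool bs) , d bs) (bitVectors (suc k))

  infix 4 _⊢_∶_ _⊢!_∶_

  mutual
    data _⊢_∶_ {n : ℕ} (Δ : Ctx n) : Term n → Type → Set (c Level.⊔ ℓ) where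

      i-sample : ∀ {d} (a : Atom) →
        IsGround Δ → name a ∉ elements (Nm (atomsᶜ Δ)) →
        Δ ⊢ sample d ∶ pos (ground (‵ a))

      -- Δ is Λ,y₁:𝒴₁,…,yₙ:𝒴ₙ, so the freshness premise covers both
      -- X ∉ {Y₁,…,Yₙ} and X ∉ Nm(Λ).
      i-cond : ∀ {k} (ys : Vec (Fin n) (suc k)) (𝒴 : Vec Atom (suc k))
        (d : Vec Bool (suc k) → Dist) (a : Atom) →
        IsGround Δ →
        (∀ i → Vec.lookup Δ (Vec.lookup ys i) ≡ ground (‵ Vec.lookup 𝒴 i)) →
        name a ∉ elements (Nm (atomsᶜ Δ)) →
        Δ ⊢ cond ys d ∶ pos (ground (‵ a))

      i-obs : ∀ {x X b} →
        IsGround Δ → Vec.lookup Δ x ≡ ground (‵ atom X (just b)) →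
        Δ ⊢ obs x b ∶ pos (ground (‵ atom X (just b)))

      i-var : ∀ {x P} →
        (∀ y → y ≢ x → IsGroundPos (Vec.lookup Δ y)) → Vec.lookup Δ x ≅⁺ P →
        Δ ⊢ val (var x) ∶ pos P

      i-let : ∀ {Δ₁ Δ₂ : Ctx n} {u t P A} →
        Δ ≣ Δ₁ ⊎ Δ₂ → Δ₁ ⊢ u ∶ pos P → P ∷ Δ₂ ⊢ t ∶ A →
        Δ ⊢ letin u t ∶ A

      i-pair : ∀ {v w L₁ L₂} →
        IsGround Δ →
        Δ ⊢ val v ∶ pos (ground L₁) → Δ ⊢ val w ∶ pos (ground L₂) →
        Δ ⊢ val ⟨ v , w ⟩ ∶ pos (ground (L₁ ⊗ L₂))

      i-letp : ∀ {v t L₁ L₂ A} →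
        groundPart Δ ⊢ val v ∶ pos (ground (L₁ ⊗ L₂)) →
        ground L₁ ∷ ground L₂ ∷ Δ ⊢ t ∶ A →
        Δ ⊢ letp v t ∶ A

      i-abs : ∀ {t P A} →
        P ∷ Δ ⊢ t ∶ A →
        Δ ⊢ ƛ t ∶ (P ⊸ A)

      i-app : ∀ {Δ₁ Δ₂ : Ctx n} {t v P A} →
        Δ ≣ Δ₁ ⊎ Δ₂ → Δ₁ ⊢ t ∶ (P ⊸ A) → Δ₂ ⊢ val v ∶ pos P →
        Δ ⊢ t · v ∶ A

      i-bang : ∀ {t As} →
        Δ ⊢! t ∶ As →
        Δ ⊢ val (! t) ∶ pos (mset As)

      i-der : ∀ {v A} →
        Δ ⊢ val v ∶ pos (mset [ A ]) →
        Δ ⊢ der v ∶ A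

    -- The list of premises of i-bang; not itself a judgment.
    data _⊢!_∶_ {n : ℕ} (Δ : Ctx n) (t : Term n) : List Type → Set (c Level.⊔ ℓ) where
      []  : IsGround Δ → Δ ⊢! t ∶ []
      cons : ∀ {Δ₁ Δ₂ : Ctx n} {A As} →
        Δ ≣ Δ₁ ⊎ Δ₂ → Δ₁ ⊢ t ∶ A → Δ₂ ⊢! t ∶ As →
        Δ ⊢! t ∶ (A ∷ As)

  mutual
    atoms : ∀ {n} {Δ : Ctx n} {t A} → Δ ⊢ t ∶ A → List Atom
    atoms {Δ = Δ} {A = A} π = atomsᴶ Δ A ++ premiseAtoms π

    premiseAtoms : ∀ {n} {Δ : Ctx n} {t A} → Δ ⊢ t ∶ A → List Atom
    premiseAtoms (i-sample _ _ _)       = []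
    premiseAtoms (i-cond _ _ _ _ _ _ _) = []
    premiseAtoms (i-obs _ _)            = []
    premiseAtoms (i-var _ _)            = []
    premiseAtoms (i-let _ π ρ)          = atoms π ++ atoms ρ
    premiseAtoms (i-pair _ π ρ)         = atoms π ++ atoms ρ
    premiseAtoms (i-letp π ρ)           = atoms π ++ atoms ρ
    premiseAtoms (i-abs π)              = atoms π
    premiseAtoms (i-app _ π ρ)          = atoms π ++ atoms ρ
    premiseAtoms (i-bang πs)            = atoms! πs
    premiseAtoms (i-der π)              = atoms π

    atoms! : ∀ {n} {Δ : Ctx n} {t As} → Δ ⊢! t ∶ As → List Atom
    atoms! ([] _)        = []
    atoms! (cons _ π πs) = atoms π ++ atoms! πs

  -- One main name per probabilistic axiom.
  mutual
    mainNames : ∀ {n} {Δ : Ctx n} {t A} → Δ ⊢ t ∶ A → List Name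
    mainNames (i-sample a _ _)       = [ name a ]
    mainNames (i-cond _ _ _ a _ _ _) = [ name a ]
    mainNames (i-obs _ _)            = []
    mainNames (i-var _ _)            = []
    mainNames (i-let _ π ρ)          = mainNames π ++ mainNames ρ
    mainNames (i-pair _ π ρ)         = mainNames π ++ mainNames ρ
    mainNames (i-letp π ρ)           = mainNames π ++ mainNames ρ
    mainNames (i-abs π)              = mainNames π
    mainNames (i-app _ π ρ)          = mainNames π ++ mainNames ρ
    mainNames (i-bang πs)            = mainNames! πs
    mainNames (i-der π)              = mainNames π

    mainNames! : ∀ {n} {Δ : Ctx n} {t As} → Δ ⊢! t ∶ As → List Name
    mainNames! ([] _)        = []
    mainNames! (cons _ π πs) = mainNames π ++ mainNames! πs

  record Derivation {n : ℕ} (Δ : Ctx n) (t : Term n) (A : Type) : Set (c Level.⊔ ℓ) where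
    field
      tree     : Δ ⊢ t ∶ A
      distinct : Unique (mainNames tree)
      coherent : ∀ {a b} → a ∈ atoms tree → b ∈ atoms tree → name a ≡ name b → a ≡ b

  open Derivation public

  Counted : ∀ {a} → Set a → Set a
  Counted A = ℕ × A

  #ops : ∀ {a} {A : Set a} → Counted A → ℕ
  #ops = proj₁

  result : ∀ {a} {A : Set a} → Counted A → A
  result = proj₂

  return : ∀ {a} {A : Set a} → A → Counted A
  return x = 0 , x

  infixl 1 _>>=_
  _>>=_ : ∀ {a b} {A : Set a} {B : Set b} → Counted A → (A → Counted B) → Counted B
  (m , x) >>= f = m +ℕ #ops (f x) , result (f x)

  add mul : Carrier → Carrier → Counted Carrier
  add x y = 1 , x + y
  mul x y = 1 , x * y

  sumᶜ : List Carrier → Counted Carrier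
  sumᶜ []           = return 0#
  sumᶜ (x ∷ [])     = return x
  sumᶜ (x ∷ y ∷ xs) = sumᶜ (y ∷ xs) >>= add x

  module Factors (ω : Observation) where

    Table : NameSet → Set c
    Table 𝕏 = Tuple ω (elements 𝕏) → Carrier

    -- The trivial factor 1_∅ is marked as such, since products with it are
    -- free; a factor over ∅ obtained by computation is an ordinary table.
    data Factor : Set c where
      𝟏     : Factor
      table : (𝕏 : NameSet) → Table 𝕏 → Factor

    names : Factor → NameSet
    names 𝟏           = ∅
    names (table 𝕏 _) = 𝕏

    -- Each entry of the table is computed exactly once.
    build : (𝕏 : NameSet) → (Tuple ω (elements 𝕏) → Counted Carrier) → Counted Factor
    build 𝕏 f = sum (List.map (#ops ∘ f) (allTuples ω (elements 𝕏))) , table 𝕏 (result ∘ f)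

    infixr 7 _⊙_
    _⊙_ : Factor → Factor → Counted Factor
    𝟏         ⊙ ψ         = return ψ
    ψ         ⊙ 𝟏         = return ψ
    table 𝕏 φ ⊙ table 𝕐 ψ =
      build (𝕏 ∪ 𝕐) λ z → mul (φ (z ∣[ ∪-⊆ˡ 𝕏 𝕐 ])) (ψ (z ∣[ ∪-⊆ʳ 𝕏 𝕐 ]))

    sumOut : (ℤ : NameSet) (φ : Factor) → ℤ ⊆ₙ names φ → Counted Factor
    sumOut ℤ 𝟏           _ = return 𝟏
    sumOut ℤ (table 𝕏 φ) _ =
      build (𝕏 ─ ℤ) λ y →
        sumᶜ (List.map (λ z → φ (++⁺ z y ∣[ ⊆-split 𝕏 ℤ ])) (allTuples ω (elements ℤ)))

    sampleFactor : Dist → Name → Factor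
    sampleFactor d X = table (fromList [ X ]) λ v → prob d (v at here refl)

    condFactor : ∀ {k} → (Vec Bool k → Dist) → Vec Name k → Name → Factor
    condFactor d Ys X =
      table (fromList (X ∷ Vec.toList Ys)) λ v →
        prob (d (Vec.tabulate λ i → v at ∈-deduplicate⁺ _≟_ (there (∈-toList⁺ (∈-lookup i Ys)))))
             (v at ∈-deduplicate⁺ _≟_ {xs = X ∷ Vec.toList Ys} (here refl))

    -- Σ_ℤ(ψ₁⊙ψ₂)  with  ℤ = (𝕐₁∪𝕐₂) − keep.
    combine : NameSet → Factor → Factor → Counted Factor
    combine keep ψ₁ ψ₂ =
      ψ₁ ⊙ ψ₂ >>= λ φ → sumOut (names φ ─ keep) φ (─-⊆ (names φ) keep)

    -- The count is the number of operations spent on the whole derivation, the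
    -- factor is that of its conclusion.

    -- In i-let and i-app, Nm(Λ,Γ₁,Γ₂,A) is the set of names of the conclusion.
    mutual
      decorate : ∀ {n} {Δ : Ctx n} {t A} → Δ ⊢ t ∶ A → Counted Factor
      decorate (i-sample {d} a _ _)     = return (sampleFactor d (name a))
      decorate (i-cond _ 𝒴 d a _ _ _)   = return (condFactor d (Vec.map name 𝒴) (name a))
      decorate (i-obs _ _)              = return 𝟏
      decorate (i-var _ _)              = return 𝟏
      decorate {Δ = Δ} {A = A} (i-let _ π ρ) =
        decorate π >>= λ ψ₁ → decorate ρ >>= λ ψ₂ → combine (Nm (atomsᴶ Δ A)) ψ₁ ψ₂
      decorate (i-pair _ π ρ) =
        decorate π >>= λ _ → decorate ρ >>= λ _ → return 𝟏
      decorate (i-letp π ρ) =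
        decorate π >>= λ _ → decorate ρ
      decorate (i-abs π)                = decorate π
      decorate {Δ = Δ} {A = A} (i-app _ π ρ) =
        decorate π >>= λ ψ₁ → decorate ρ >>= λ ψ₂ → combine (Nm (atomsᴶ Δ A)) ψ₁ ψ₂
      decorate (i-bang πs)              = decorate! πs
      decorate (i-der π)                = decorate π

      decorate! : ∀ {n} {Δ : Ctx n} {t As} → Δ ⊢! t ∶ As → Counted Factor
      decorate! ([] _)        = return 𝟏
      decorate! (cons _ π πs) =
        decorate π >>= λ ψ → decorate! πs >>= λ ψs → ψ ⊙ ψs

    -- The sets of names of the factors arising in the decoration: that of each
    -- judgment and, in i-let and i-app, also the set 𝕐₁∪𝕐₂ of the product
    -- ψ₁⊙ψ₂, which is tabulated before ℤ is summed out.
    mutual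
      nameSets : ∀ {n} {Δ : Ctx n} {t A} → Δ ⊢ t ∶ A → List NameSet
      nameSets π = names (result (decorate π)) ∷ innerNameSets π

      innerNameSets : ∀ {n} {Δ : Ctx n} {t A} → Δ ⊢ t ∶ A → List NameSet
      innerNameSets (i-sample _ _ _)       = []
      innerNameSets (i-cond _ _ _ _ _ _ _) = []
      innerNameSets (i-obs _ _)            = []
      innerNameSets (i-var _ _)            = []
      innerNameSets (i-let _ π ρ)          = productNameSet π ρ ∷ nameSets π ++ nameSets ρ
      innerNameSets (i-pair _ π ρ)         = nameSets π ++ nameSets ρ
      innerNameSets (i-letp π ρ)           = nameSets π ++ nameSets ρ
      innerNameSets (i-abs π)              = nameSets π
      innerNameSets (i-app _ π ρ)          = productNameSet π ρ ∷ nameSets π ++ nameSets ρ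
      innerNameSets (i-bang πs)            = nameSets! πs
      innerNameSets (i-der π)              = nameSets π

      nameSets! : ∀ {n} {Δ : Ctx n} {t As} → Δ ⊢! t ∶ As → List NameSet
      nameSets! ([] _)        = []
      nameSets! (cons _ π πs) = nameSets π ++ nameSets! πs

      productNameSet : ∀ {n m} {Δ : Ctx n} {t A} {Δ′ : Ctx m} {t′ A′} →
        Δ ⊢ t ∶ A → Δ′ ⊢ t′ ∶ A′ → NameSet
      productNameSet π ρ = names (result (decorate π)) ∪ names (result (decorate ρ))

    mutual
      cpts : ∀ {n} {Δ : Ctx n} {t A} → Δ ⊢ t ∶ A → List Factor
      cpts (i-sample {d} a _ _)   = [ sampleFactor d (name a) ]
      cpts (i-cond _ 𝒴 d a _ _ _) = [ condFactor d (Vec.map name 𝒴) (name a) ]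
      cpts (i-obs _ _)            = []
      cpts (i-var _ _)            = []
      cpts (i-let _ π ρ)          = cpts π ++ cpts ρ
      cpts (i-pair _ π ρ)         = cpts π ++ cpts ρ
      cpts (i-letp π ρ)           = cpts π ++ cpts ρ
      cpts (i-abs π)              = cpts π
      cpts (i-app _ π ρ)          = cpts π ++ cpts ρ
      cpts (i-bang πs)            = cpts! πs
      cpts (i-der π)              = cpts π

      cpts! : ∀ {n} {Δ : Ctx n} {t As} → Δ ⊢! t ∶ As → List Factor
      cpts! ([] _)        = []
      cpts! (cons _ π πs) = cpts π ++ cpts! πs

  module _ {n : ℕ} {Δ : Ctx n} {t : Term n} {A : Type} (π : Derivation Δ t A) where

    open Factors (observation (atoms (tree π)))

    #axioms : ℕ
    #axioms = length (mainNames (tree π))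

    #names : ℕ
    #names = ∣ ⋃ (List.map names (cpts (tree π))) ∣

    cost : ℕ
    cost = #ops (decorate (tree π))

    width : ℕ
    width = foldr _⊔_ 0 (List.map ∣_∣ (nameSets (tree π)))

{-# OPTIONS --safe #-}

-- Amortised analysis.  Put B = 2^W and give a tabulated factor over 𝕏 the
-- potential |Val(𝕏)| + 2B, and the trivial factor the potential 0.  Multiplying
-- two tables costs |Val(𝕏∪𝕐)| ≤ B and merges two terms 2B into one, which pays
-- for the product and for the new entries.  Summing ℤ out of a table over 𝕏 costs
-- |Val(𝕏−ℤ)|·(|Val(ℤ)| − 1) = |Val(𝕏)| − |Val(𝕏−ℤ)|, exactly the drop in
-- potential, so the number of let's and applications, which is not bounded in
-- terms of m_π, does not matter.  Hence cost plus potential never exceeds the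
-- total potential of the axioms, which is at most 3B each.

module Submission where

open import Defs
open import Algebra.Bundles using (CommutativeSemiring)
open import Data.List using (List; []; _∷_; _++_; length; map; foldr; cartesianProductWith)
open import Data.List.Membership.Propositional using (_∈_)
open import Data.List.Membership.Propositional.Properties
  using (∈-∃++; ∈-++⁻; ∈-deduplicate⁻; ∈-filter⁻)
open import Data.List.Membership.DecPropositional using (_∈?_)
open import Data.List.Properties using (length-map; length-++; map-++)
open import Data.List.Relation.Binary.Permutation.Propositional
  using (_↭_; ↭-refl; ↭-trans; prep)
open import Data.List.Relation.Binary.Permutation.Propositional.Properties
  using (∈-resp-↭; shift; ↭-length; map⁺)
open import Data.List.Relation.Binary.Subset.Propositional using (_⊆_)
open import Data.List.Relation.Unary.All as All using (All; []; _∷_)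
open import Data.List.Relation.Unary.All.Properties as All using (++⁺; ++⁻ˡ; ++⁻ʳ)
open import Data.List.Relation.Unary.AllPairs using ([]; _∷_)
open import Data.List.Relation.Unary.Any using (here; there)
open import Data.List.Relation.Unary.Unique.Propositional using (Unique)
import Data.List.Relation.Unary.Unique.Propositional.Properties as Unique
open import Data.Maybe using (just; nothing)
open import Data.Nat
  using (ℕ; suc; pred; NonZero; nonZero; z≤n; s≤s; _≤_; _+_; _*_; _^_; _⊔_; _≟_)
open import Data.Nat.ListAction using (sum; product)
open import Data.Nat.ListAction.Properties using (product-++; product-↭; product≢0)
open import Data.Nat.Properties
open import Data.Nat.Tactic.RingSolver using (solve-∀)
open import Data.Product using (∃; _×_; _,_; proj₁; proj₂)
open import Data.Sum using ([_,_]′)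
open import Function using (_∘_; id)
open import Relation.Binary.PropositionalEquality
  using (_≡_; refl; sym; trans; cong; cong₂; subst)
open import Relation.Nullary using (¬?; contradiction)

-- Duplicate-free lists and elementary counting.

module _ {a} {A : Set a} where

  -- Induction on `xs`: one occurrence of the head is deleted from `ys`, and the tail survives the
  -- deletion because it does not contain the head. The witness `zs` is what is left of `ys`. It
  -- serves comparisons both of lengths and of products indexed by names.
  Unique-⊆⇒↭ : ∀ {xs ys : List A} → Unique xs → xs ⊆ ys → ∃ λ zs → ys ↭ xs ++ zs
  Unique-⊆⇒↭ {[]}     {ys} []         _     = ys , ↭-refl
  Unique-⊆⇒↭ {x ∷ xs} {ys} (x∉ ∷ xs!) xs⊆ys with ∈-∃++ (xs⊆ys (here refl))
  ... | as , bs , refl = zs , ↭-trans (shift x as bs) (prep x as++bs↭)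
    where
    xs⊆ : xs ⊆ as ++ bs
    xs⊆ y∈xs with ∈-resp-↭ (shift x as bs) (xs⊆ys (there y∈xs))
    ... | here refl = contradiction refl (All.lookup x∉ y∈xs)
    ... | there y∈  = y∈

    zs      = proj₁ (Unique-⊆⇒↭ xs! xs⊆)
    as++bs↭ = proj₂ (Unique-⊆⇒↭ xs! xs⊆)

  Unique-⊆⇒length≤ : ∀ {xs ys : List A} → Unique xs → xs ⊆ ys → length xs ≤ length ys
  Unique-⊆⇒length≤ {xs} {ys} xs! xs⊆ys = let zs , ys↭ = Unique-⊆⇒↭ xs! xs⊆ys in begin
    length xs              ≤⟨ m≤m+n _ _ ⟩
    length xs + length zs  ≡⟨ length-++ xs ⟨
    length (xs ++ zs)      ≡⟨ ↭-length ys↭ ⟨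
    length ys              ∎
    where open ≤-Reasoning

  sum-map-const : ∀ (f : A → ℕ) {k} → (∀ x → f x ≡ k) → ∀ xs → sum (map f xs) ≡ length xs * k
  sum-map-const f f≡k []       = refl
  sum-map-const f f≡k (x ∷ xs) = cong₂ _+_ (f≡k x) (sum-map-const f f≡k xs)

length-cartesianProductWith : ∀ {a b c} {A : Set a} {B : Set b} {C : Set c}
  (f : A → B → C) xs ys → length (cartesianProductWith f xs ys) ≡ length xs * length ys
length-cartesianProductWith f []       ys = refl
length-cartesianProductWith f (x ∷ xs) ys = trans (length-++ (map (f x) ys))
  (cong₂ _+_ (length-map (f x) ys) (length-cartesianProductWith f xs ys))

maximum≤ : ∀ {k ms} → All (_≤ k) ms → foldr _⊔_ 0 ms ≤ k
maximum≤ []         = z≤n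
maximum≤ (m≤ ∷ ms≤) = ⊔-lub m≤ (maximum≤ ms≤)

≤maximum : ∀ ms → All (_≤ foldr _⊔_ 0 ms) ms
≤maximum []       = []
≤maximum (m ∷ ms) = m≤m⊔n m _ ∷ All.map (m≤n⇒m≤o⊔n m) (≤maximum ms)

-- Inclusions of name sets.

∣∣-mono : ∀ 𝕏 𝕐 → 𝕏 ⊆ₙ 𝕐 → ∣ 𝕏 ∣ ≤ ∣ 𝕐 ∣
∣∣-mono 𝕏 𝕐 = Unique-⊆⇒length≤ (unique 𝕏)

∪-least : ∀ 𝕏 𝕐 𝕌 → 𝕏 ⊆ₙ 𝕌 → 𝕐 ⊆ₙ 𝕌 → (𝕏 ∪ 𝕐) ⊆ₙ 𝕌
∪-least 𝕏 𝕐 𝕌 𝕏⊆𝕌 𝕐⊆𝕌 =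
  [ 𝕏⊆𝕌 , 𝕐⊆𝕌 ]′ ∘ ∈-++⁻ (elements 𝕏) ∘ ∈-deduplicate⁻ _≟_ (elements 𝕏 ++ elements 𝕐)

⊆-⋃ : ∀ 𝕏s → All (λ 𝕏 → 𝕏 ⊆ₙ ⋃ 𝕏s) 𝕏s
⊆-⋃ []       = []
⊆-⋃ (𝕏 ∷ 𝕏s) =
  ∪-⊆ˡ 𝕏 (⋃ 𝕏s) ∷ All.map (λ 𝕐⊆ {x} x∈ → ∪-⊆ʳ 𝕏 (⋃ 𝕏s) (𝕐⊆ {x} x∈)) (⊆-⋃ 𝕏s)

-- Number of value tuples over a list of names.

module _ (ω : Observation) where

  #tuples : List Name → ℕ
  #tuples xs = length (allTuples ω xs)

  #vals : Name → ℕ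
  #vals = length ∘ allVals ∘ ω

  -- Tuples over permuted lists have different types, but a product of numbers is invariant under
  -- permutation; comparisons of counts go through this form.
  #tuples-product : ∀ xs → #tuples xs ≡ product (map #vals xs)
  #tuples-product []       = refl
  #tuples-product (x ∷ xs) = trans
    (length-cartesianProductWith _∷_ (allVals (ω x)) (allTuples ω xs))
    (cong (#vals x *_) (#tuples-product xs))

  #vals-bounds : ∀ x → NonZero (#vals x) × #vals x ≤ 2
  #vals-bounds x with ω x
  ... | nothing = nonZero , ≤-refl
  ... | just _  = nonZero , s≤s z≤n

  -- Even an observed name keeps one value, so no table is empty. Monotonicity of the count and the
  -- `pred` in the cost of a sum out both rest on this.
  #tuples≢0 : ∀ xs → NonZero (#tuples xs)
  #tuples≢0 xs = subst NonZero (sym (#tuples-product xs))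
    (product≢0 (All.map⁺ (All.universal (proj₁ ∘ #vals-bounds) xs)))

  #tuples≤2^ : ∀ xs → #tuples xs ≤ 2 ^ length xs
  #tuples≤2^ []       = ≤-refl
  #tuples≤2^ (x ∷ xs) = ≤-trans
    (≤-reflexive (length-cartesianProductWith _∷_ (allVals (ω x)) (allTuples ω xs)))
    (*-mono-≤ (proj₂ (#vals-bounds x)) (#tuples≤2^ xs))

  #tuples-++ : ∀ xs ys → #tuples (xs ++ ys) ≡ #tuples xs * #tuples ys
  #tuples-++ xs ys rewrite #tuples-product xs | #tuples-product ys =
    trans (#tuples-product (xs ++ ys))
      (trans (cong product (map-++ #vals xs ys)) (product-++ (map #vals xs) (map #vals ys)))

  -- `ys` is a permutation of `xs ++ zs`, and the extra factor `#tuples zs` is at least one.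
  #tuples-mono : ∀ {xs ys} → Unique xs → xs ⊆ ys → #tuples xs ≤ #tuples ys
  #tuples-mono {xs} {ys} xs! xs⊆ys = let zs , ys↭ = Unique-⊆⇒↭ xs! xs⊆ys in begin
    #tuples xs                     ≤⟨ m≤m*n _ _ ⦃ #tuples≢0 zs ⦄ ⟩
    #tuples xs * #tuples zs        ≡⟨ #tuples-++ xs zs ⟨
    #tuples (xs ++ zs)             ≡⟨ #tuples-product (xs ++ zs) ⟩
    product (map #vals (xs ++ zs)) ≡⟨ product-↭ (map⁺ #vals ys↭) ⟨
    product (map #vals ys)         ≡⟨ #tuples-product ys ⟨
    #tuples ys                     ∎
    where open ≤-Reasoning

  -- The two sets are disjoint, so their concatenation is a duplicate-free list of names of `𝕏`.
  -- This inequality is what makes a sum out pay for itself.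
  #tuples-─ : ∀ 𝕏 ℤ → ℤ ⊆ₙ 𝕏 →
    #tuples (elements (𝕏 ─ ℤ)) * #tuples (elements ℤ) ≤ #tuples (elements 𝕏)
  #tuples-─ 𝕏 ℤ ℤ⊆𝕏 = ≤-trans
    (≤-reflexive (sym (#tuples-++ (elements (𝕏 ─ ℤ)) (elements ℤ))))
    (#tuples-mono (Unique.++⁺ (unique (𝕏 ─ ℤ)) (unique ℤ) disjoint)
                  ([ ─-⊆ 𝕏 ℤ , ℤ⊆𝕏 ]′ ∘ ∈-++⁻ (elements (𝕏 ─ ℤ))))
    where
    disjoint : ∀ {x} → x ∈ elements (𝕏 ─ ℤ) × x ∈ elements ℤ → _
    disjoint (x∈𝕏─ℤ , x∈ℤ) =
      proj₂ (∈-filter⁻ (λ x → ¬? (_∈?_ _≟_ x (elements ℤ))) {xs = elements 𝕏} x∈𝕏─ℤ) x∈ℤ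

module _ {c ℓ} (R : CommutativeSemiring c ℓ) where

  open Calculus R

  -- The addition saved on each sum is exactly what covers the new entry in `amortised-sumOut`.
  #ops-sumᶜ : ∀ xs → #ops (sumᶜ xs) ≡ pred (length xs)
  #ops-sumᶜ []           = refl
  #ops-sumᶜ (_ ∷ [])     = refl
  #ops-sumᶜ (_ ∷ y ∷ xs) = trans (+-comm _ 1) (cong suc (#ops-sumᶜ (y ∷ xs)))

  -- Names of products and sum outs.

  module _ (ω : Observation) where

    open Factors ω

    -- Needed for (i-bang), where a width bound on a whole product has to pass to the product of the
    -- remaining premises.
    names-⊙ʳ : ∀ φ ψ → names ψ ⊆ₙ names (result (φ ⊙ ψ))
    names-⊙ʳ 𝟏           ψ           = id
    names-⊙ʳ (table 𝕏 _) 𝟏           ()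
    names-⊙ʳ (table 𝕏 _) (table 𝕐 _) = ∪-⊆ʳ 𝕏 𝕐

    -- `productNameSet` is a union even when one operand is `𝟏`; the inclusion transfers its width
    -- bound to the product actually computed.
    names-⊙ : ∀ φ ψ → names (result (φ ⊙ ψ)) ⊆ₙ (names φ ∪ names ψ)
    names-⊙ 𝟏           ψ           = ∪-⊆ʳ ∅ (names ψ)
    names-⊙ (table 𝕏 _) 𝟏           = ∪-⊆ˡ 𝕏 ∅
    names-⊙ (table 𝕏 _) (table 𝕐 _) = id

    names-sumOut : ∀ ℤ φ (ℤ⊆ : ℤ ⊆ₙ names φ) → names (result (sumOut ℤ φ ℤ⊆)) ⊆ₙ names φ
    names-sumOut ℤ 𝟏           _ = id
    names-sumOut ℤ (table 𝕏 _) _ = ─-⊆ 𝕏 ℤ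

    names-combine : ∀ keep φ ψ → names (result (combine keep φ ψ)) ⊆ₙ (names φ ∪ names ψ)
    names-combine keep φ ψ =
      names-⊙ φ ψ ∘ names-sumOut (names φψ ─ keep) φψ (─-⊆ (names φψ) keep)
      where φψ = result (φ ⊙ ψ)

    -- The decoration uses only names of the components.

    module _ (𝕌 : NameSet) where

      _Within : Factor → Set
      φ Within = names φ ⊆ₙ 𝕌

      mutual
        -- Products only join name sets and sum outs only shrink them. With an arbitrary upper bound
        -- `𝕌` in place of the union over `cpts π`, the hypothesis simply splits at each rule and no
        -- unions need rearranging.
        decorate-⊆ : ∀ {n} {Δ : Ctx n} {t A} (π : Δ ⊢ t ∶ A) →
          All _Within (cpts π) → names (result (decorate π)) ⊆ₙ 𝕌
        decorate-⊆ (i-sample _ _ _)       (h ∷ []) = h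
        decorate-⊆ (i-cond _ _ _ _ _ _ _) (h ∷ []) = h
        decorate-⊆ (i-obs _ _)            h ()
        decorate-⊆ (i-var _ _)            h ()
        decorate-⊆ {Δ = Δ} {A = A} (i-let _ π ρ) h =
          product-⊆ π ρ h ∘ names-combine (Nm (atomsᴶ Δ A)) (result (decorate π)) (result (decorate ρ))
        decorate-⊆ (i-pair _ π ρ)         h ()
        decorate-⊆ (i-letp π ρ)           h = decorate-⊆ ρ (++⁻ʳ (cpts π) h)
        decorate-⊆ (i-abs π)              h = decorate-⊆ π h
        decorate-⊆ {Δ = Δ} {A = A} (i-app _ π ρ) h =
          product-⊆ π ρ h ∘ names-combine (Nm (atomsᴶ Δ A)) (result (decorate π)) (result (decorate ρ))
        decorate-⊆ (i-bang πs)            h = decorate!-⊆ πs h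
        decorate-⊆ (i-der π)              h = decorate-⊆ π h

        decorate!-⊆ : ∀ {n} {Δ : Ctx n} {t As} (πs : Δ ⊢! t ∶ As) →
          All _Within (cpts! πs) → names (result (decorate! πs)) ⊆ₙ 𝕌
        decorate!-⊆ ([] _)        h ()
        decorate!-⊆ (cons _ π πs) h =
          ∪-least (names (result (decorate π))) (names (result (decorate! πs))) 𝕌
            (decorate-⊆ π (++⁻ˡ (cpts π) h)) (decorate!-⊆ πs (++⁻ʳ (cpts π) h))
          ∘ names-⊙ (result (decorate π)) (result (decorate! πs))

        product-⊆ : ∀ {n m} {Δ : Ctx n} {t A} {Δ′ : Ctx m} {t′ A′}
          (π : Δ ⊢ t ∶ A) (ρ : Δ′ ⊢ t′ ∶ A′) →
          All _Within (cpts π ++ cpts ρ) → productNameSet π ρ ⊆ₙ 𝕌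
        product-⊆ π ρ h =
          ∪-least (names (result (decorate π))) (names (result (decorate ρ))) 𝕌
            (decorate-⊆ π (++⁻ˡ (cpts π) h)) (decorate-⊆ ρ (++⁻ʳ (cpts π) h))

      mutual
        nameSets-⊆ : ∀ {n} {Δ : Ctx n} {t A} (π : Δ ⊢ t ∶ A) →
          All _Within (cpts π) → All (_⊆ₙ 𝕌) (nameSets π)
        nameSets-⊆ π h = decorate-⊆ π h ∷ innerNameSets-⊆ π h

        innerNameSets-⊆ : ∀ {n} {Δ : Ctx n} {t A} (π : Δ ⊢ t ∶ A) →
          All _Within (cpts π) → All (_⊆ₙ 𝕌) (innerNameSets π)
        innerNameSets-⊆ (i-sample _ _ _)       h = []
        innerNameSets-⊆ (i-cond _ _ _ _ _ _ _) h = []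
        innerNameSets-⊆ (i-obs _ _)            h = []
        innerNameSets-⊆ (i-var _ _)            h = []
        innerNameSets-⊆ (i-let _ π ρ)          h = product-⊆ π ρ h ∷ nameSets-++-⊆ π ρ h
        innerNameSets-⊆ (i-pair _ π ρ)         h = nameSets-++-⊆ π ρ h
        innerNameSets-⊆ (i-letp π ρ)           h = nameSets-++-⊆ π ρ h
        innerNameSets-⊆ (i-abs π)              h = nameSets-⊆ π h
        innerNameSets-⊆ (i-app _ π ρ)          h = product-⊆ π ρ h ∷ nameSets-++-⊆ π ρ h
        innerNameSets-⊆ (i-bang πs)            h = nameSets!-⊆ πs h
        innerNameSets-⊆ (i-der π)              h = nameSets-⊆ π h

        nameSets-++-⊆ : ∀ {n m} {Δ : Ctx n} {t A} {Δ′ : Ctx m} {t′ A′}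
          (π : Δ ⊢ t ∶ A) (ρ : Δ′ ⊢ t′ ∶ A′) →
          All _Within (cpts π ++ cpts ρ) → All (_⊆ₙ 𝕌) (nameSets π ++ nameSets ρ)
        nameSets-++-⊆ π ρ h =
          ++⁺ (nameSets-⊆ π (++⁻ˡ (cpts π) h)) (nameSets-⊆ ρ (++⁻ʳ (cpts π) h))

        nameSets!-⊆ : ∀ {n} {Δ : Ctx n} {t As} (πs : Δ ⊢! t ∶ As) →
          All _Within (cpts! πs) → All (_⊆ₙ 𝕌) (nameSets! πs)
        nameSets!-⊆ ([] _)        h = []
        nameSets!-⊆ (cons _ π πs) h =
          ++⁺ (nameSets-⊆ π (++⁻ˡ (cpts π) h)) (nameSets!-⊆ πs (++⁻ʳ (cpts π) h))

    -- Potential and amortised cost of the operations.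

    module _ (W : ℕ) where

      Narrow : NameSet → Set
      Narrow 𝕏 = ∣ 𝕏 ∣ ≤ W

      #tuples≤2^W : ∀ 𝕏 → Narrow 𝕏 → #tuples ω (elements 𝕏) ≤ 2 ^ W
      #tuples≤2^W 𝕏 𝕏≤W = ≤-trans (#tuples≤2^ ω (elements 𝕏)) (^-monoʳ-≤ 2 𝕏≤W)

      -- `𝟏` must have potential `0`: (i-var) and (i-obs) produce it without contributing a main
      -- name, hence without any budget.
      potential : Factor → ℕ
      potential 𝟏           = 0
      potential (table 𝕏 _) = #tuples ω (elements 𝕏) + 2 * 2 ^ W

      amortised : Counted Factor → ℕ
      amortised (k , φ) = k + potential φ

      -- The factor `1` is the length of the list of main names of a single axiom.
      potential≤ : ∀ φ → Narrow (names φ) → potential φ ≤ 1 * (3 * 2 ^ W)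
      potential≤ 𝟏           _   = z≤n
      potential≤ (table 𝕏 _) 𝕏≤W = ≤-trans (+-monoˡ-≤ _ (#tuples≤2^W 𝕏 𝕏≤W))
        (≤-reflexive (sym (*-identityˡ (3 * 2 ^ W))))

      amortised-⊙ : ∀ φ ψ → Narrow (names (result (φ ⊙ ψ))) →
        amortised (φ ⊙ ψ) ≤ potential φ + potential ψ
      amortised-⊙ 𝟏           ψ _ = ≤-refl
      amortised-⊙ (table 𝕏 _) 𝟏 _ = m≤m+n _ 0
      amortised-⊙ (table 𝕏 φ) (table 𝕐 ψ) 𝕏∪𝕐≤W = begin
        #ops (table 𝕏 φ ⊙ table 𝕐 ψ) + (T + 2 * B)
          ≡⟨ cong (_+ (T + 2 * B)) (sum-map-const _ (λ _ → refl) (allTuples ω (elements (𝕏 ∪ 𝕐)))) ⟩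
        -- `T * 1` counts the multiplications, one per entry; the second `T` belongs to the
        -- potential of the new table.
        T * 1 + (T + 2 * B)  ≤⟨ +-mono-≤ (*-monoˡ-≤ 1 T≤B) (+-monoˡ-≤ (2 * B) T≤B) ⟩
        B * 1 + (B + 2 * B)  ≡⟨ regroup B ⟩
        2 * B + 2 * B
          -- The reserves `2 * B` of the operands suffice; their entry counts are dropped.
          ≤⟨ +-mono-≤ (m≤n+m (2 * B) (#tuples ω (elements 𝕏)))
                      (m≤n+m (2 * B) (#tuples ω (elements 𝕐))) ⟩
        potential (table 𝕏 φ) + potential (table 𝕐 ψ) ∎
        where
        open ≤-Reasoning
        B = 2 ^ W
        T = #tuples ω (elements (𝕏 ∪ 𝕐))

        T≤B : T ≤ B
        T≤B = #tuples≤2^W (𝕏 ∪ 𝕐) 𝕏∪𝕐≤W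

        regroup : ∀ b → b * 1 + (b + 2 * b) ≡ 2 * b + 2 * b
        regroup = solve-∀

      amortised-sumOut : ∀ ℤ φ (ℤ⊆ : ℤ ⊆ₙ names φ) → amortised (sumOut ℤ φ ℤ⊆) ≤ potential φ
      amortised-sumOut ℤ 𝟏           _  = z≤n
      amortised-sumOut ℤ (table 𝕏 φ) ℤ⊆ = begin
        #ops (sumOut ℤ (table 𝕏 φ) ℤ⊆) + (Y + 2 * B)
          ≡⟨ cong (_+ (Y + 2 * B))
               (sum-map-const (#ops ∘ sumᶜ ∘ entries) #ops-entries (allTuples ω (elements (𝕏 ─ ℤ)))) ⟩
        -- Additions and new entries together make `Y * Z`, at most the old number of entries; the
        -- reserve `2 * B` passes on untouched.
        Y * pred Z + (Y + 2 * B)  ≡⟨ +-assoc (Y * pred Z) Y _ ⟨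
        Y * pred Z + Y + 2 * B    ≡⟨ cong (_+ 2 * B) (+-comm (Y * pred Z) Y) ⟩
        Y + Y * pred Z + 2 * B    ≡⟨ cong (_+ 2 * B) (*-suc Y (pred Z)) ⟨
        Y * suc (pred Z) + 2 * B
          -- For `Z` equal to zero, `suc (pred Z)` would be one.
          ≡⟨ cong (λ z → Y * z + 2 * B) (suc-pred Z ⦃ #tuples≢0 ω (elements ℤ) ⦄) ⟩
        Y * Z + 2 * B             ≤⟨ +-monoˡ-≤ (2 * B) (#tuples-─ ω 𝕏 ℤ ℤ⊆) ⟩
        potential (table 𝕏 φ)     ∎
        where
        open ≤-Reasoning
        B = 2 ^ W
        Y = #tuples ω (elements (𝕏 ─ ℤ))
        Z = #tuples ω (elements ℤ)

        φ∣ : Tuple ω (elements (𝕏 ─ ℤ)) → Tuple ω (elements ℤ) → _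
        φ∣ y z = φ (++⁺ z y ∣[ ⊆-split 𝕏 ℤ ])

        entries : Tuple ω (elements (𝕏 ─ ℤ)) → List _
        entries y = map (φ∣ y) (allTuples ω (elements ℤ))

        #ops-entries : ∀ y → #ops (sumᶜ (entries y)) ≡ pred Z
        #ops-entries y =
          trans (#ops-sumᶜ (entries y)) (cong pred (length-map (φ∣ y) (allTuples ω (elements ℤ))))

      -- `k` is the budget of the continuation beyond the potential of its input: `0` for a sum out,
      -- `amortised m′` for an independent computation `m′`.
      amortised->>= : ∀ {k} m (f : Factor → Counted Factor) →
        amortised (f (result m)) ≤ potential (result m) + k → amortised (m >>= f) ≤ amortised m + k
      amortised->>= {k} (i , φ) f h = begin
        i + #ops (f φ) + potential (result (f φ)) ≡⟨ +-assoc i _ _ ⟩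
        i + amortised (f φ)                       ≤⟨ +-monoʳ-≤ i h ⟩
        i + (potential φ + k)                     ≡⟨ +-assoc i _ k ⟨
        i + potential φ + k                       ∎
        where open ≤-Reasoning

      amortised->>=-const : ∀ (m m′ : Counted Factor) →
        amortised (m >>= λ _ → m′) ≤ amortised m + amortised m′
      amortised->>=-const m m′ = amortised->>= m (λ _ → m′) (m≤n+m (amortised m′) (potential (result m)))

      amortised->>=₂ : ∀ m m′ (f : Factor → Factor → Counted Factor) →
        amortised (f (result m) (result m′)) ≤ potential (result m) + potential (result m′) →
        amortised (m >>= λ φ → m′ >>= f φ) ≤ amortised m + amortised m′
      amortised->>=₂ (i , φ) (j , ψ) f h = begin
        i + (j + #ops (f φ ψ)) + potential (result (f φ ψ)) ≡⟨ assoc i j (#ops (f φ ψ)) _ ⟩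
        i + j + amortised (f φ ψ)                           ≤⟨ +-monoʳ-≤ (i + j) h ⟩
        i + j + (potential φ + potential ψ)                 ≡⟨ interchange i j _ _ ⟩
        i + potential φ + (j + potential ψ)                 ∎
        where
        open ≤-Reasoning
        assoc : ∀ a b c d → a + (b + c) + d ≡ a + b + (c + d)
        assoc = solve-∀
        interchange : ∀ a b c d → a + b + (c + d) ≡ a + c + (b + d)
        interchange = solve-∀

      -- The sum out is free in amortised terms, so the bound is that of the product alone.
      amortised-combine : ∀ keep φ ψ → Narrow (names φ ∪ names ψ) →
        amortised (combine keep φ ψ) ≤ potential φ + potential ψ
      amortised-combine keep φ ψ narrow = begin
        amortised (combine keep φ ψ)
          ≤⟨ amortised->>= (φ ⊙ ψ) (λ χ → sumOut (names χ ─ keep) χ (─-⊆ (names χ) keep))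
               (≤-trans (amortised-sumOut (names φψ ─ keep) φψ (─-⊆ (names φψ) keep)) (m≤m+n _ 0)) ⟩
        amortised (φ ⊙ ψ) + 0 ≡⟨ +-identityʳ _ ⟩
        amortised (φ ⊙ ψ)
          ≤⟨ amortised-⊙ φ ψ (≤-trans (∣∣-mono (names φψ) (names φ ∪ names ψ) (names-⊙ φ ψ)) narrow) ⟩
        potential φ + potential ψ ∎
        where
        open ≤-Reasoning
        φψ = result (φ ⊙ ψ)

      -- Amortised bound for whole derivations.

      split-bound : ∀ (xs ys : List Name) {i j k} → k ≤ i + j →
        i ≤ length xs * (3 * 2 ^ W) → j ≤ length ys * (3 * 2 ^ W) →
        k ≤ length (xs ++ ys) * (3 * 2 ^ W)
      split-bound xs ys {i} {j} {k} k≤ i≤ j≤ = begin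
        k                                                 ≤⟨ k≤ ⟩
        i + j                                             ≤⟨ +-mono-≤ i≤ j≤ ⟩
        length xs * (3 * 2 ^ W) + length ys * (3 * 2 ^ W) ≡⟨ *-distribʳ-+ (3 * 2 ^ W) (length xs) _ ⟨
        (length xs + length ys) * (3 * 2 ^ W)             ≡⟨ cong (_* (3 * 2 ^ W)) (length-++ xs) ⟨
        length (xs ++ ys) * (3 * 2 ^ W)                   ∎
        where open ≤-Reasoning

      mutual
        -- Bounding cost plus potential is what lets the induction close: the potential left by the
        -- premises pays for the rule. For let and application, `h` bounds the product table before
        -- summing out, listed right after the set of the judgment.
        amortised-decorate : ∀ {n} {Δ : Ctx n} {t A} (π : Δ ⊢ t ∶ A) → All Narrow (nameSets π) →
          amortised (decorate π) ≤ length (mainNames π) * (3 * 2 ^ W)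
        amortised-decorate π@(i-sample _ _ _)       (h ∷ _) = potential≤ (result (decorate π)) h
        amortised-decorate π@(i-cond _ _ _ _ _ _ _) (h ∷ _) = potential≤ (result (decorate π)) h
        amortised-decorate (i-obs _ _)              _       = z≤n
        amortised-decorate (i-var _ _)              _       = z≤n
        amortised-decorate {Δ = Δ} {A = A} (i-let _ π ρ) (_ ∷ h ∷ hs) =
          amortised-decorate₂ π ρ (amortised->>=₂ (decorate π) (decorate ρ) (combine (Nm (atomsᴶ Δ A)))
            (amortised-combine (Nm (atomsᴶ Δ A)) (result (decorate π)) (result (decorate ρ)) h)) hs
        amortised-decorate (i-pair _ π ρ)           (_ ∷ hs) =
          amortised-decorate₂ π ρ (amortised->>=₂ (decorate π) (decorate ρ) (λ _ _ → return 𝟏) z≤n) hs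
        amortised-decorate (i-letp π ρ)             (_ ∷ hs) =
          amortised-decorate₂ π ρ (amortised->>=-const (decorate π) (decorate ρ)) hs
        amortised-decorate (i-abs π)                (_ ∷ hs) = amortised-decorate π hs
        amortised-decorate {Δ = Δ} {A = A} (i-app _ π ρ) (_ ∷ h ∷ hs) =
          amortised-decorate₂ π ρ (amortised->>=₂ (decorate π) (decorate ρ) (combine (Nm (atomsᴶ Δ A)))
            (amortised-combine (Nm (atomsᴶ Δ A)) (result (decorate π)) (result (decorate ρ)) h)) hs
        amortised-decorate (i-bang πs)              (h ∷ hs) = amortised-decorate! πs h hs
        amortised-decorate (i-der π)                (_ ∷ hs) = amortised-decorate π hs

        amortised-decorate₂ : ∀ {n m} {Δ : Ctx n} {t A} {Δ′ : Ctx m} {t′ A′}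
          (π : Δ ⊢ t ∶ A) (ρ : Δ′ ⊢ t′ ∶ A′) {k : ℕ} →
          k ≤ amortised (decorate π) + amortised (decorate ρ) → All Narrow (nameSets π ++ nameSets ρ) →
          k ≤ length (mainNames π ++ mainNames ρ) * (3 * 2 ^ W)
        amortised-decorate₂ π ρ k≤ hs = split-bound (mainNames π) (mainNames ρ) k≤
          (amortised-decorate π (++⁻ˡ (nameSets π) hs)) (amortised-decorate ρ (++⁻ʳ (nameSets π) hs))

        -- `nameSets!` does not record partial products. Their width is controlled by the extra
        -- hypothesis on the whole product: it is folded from the right without summing out, so each
        -- partial product has a subset of its names.
        amortised-decorate! : ∀ {n} {Δ : Ctx n} {t As} (πs : Δ ⊢! t ∶ As) →
          Narrow (names (result (decorate! πs))) → All Narrow (nameSets! πs) →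
          amortised (decorate! πs) ≤ length (mainNames! πs) * (3 * 2 ^ W)
        amortised-decorate! ([] _)        _ _  = z≤n
        amortised-decorate! (cons _ π πs) h hs = split-bound (mainNames π) (mainNames! πs)
          (amortised->>=₂ (decorate π) (decorate! πs) _⊙_ (amortised-⊙ ψ ψs h))
          (amortised-decorate π (++⁻ˡ (nameSets π) hs))
          (amortised-decorate! πs (≤-trans (∣∣-mono (names ψs) (names (result (ψ ⊙ ψs))) (names-⊙ʳ ψ ψs)) h)
                              (++⁻ʳ (nameSets π) hs))
          where
          ψ  = result (decorate π)
          ψs = result (decorate! πs)

  -- Width and cost of a derivation.

  module _ {n : ℕ} {Δ : Ctx n} {t : Term n} {A : Type} (π : Derivation Δ t A) where

    private ω = observation (atoms (tree π))
    open Factors ω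

    width≤#names : width π ≤ #names π
    width≤#names = maximum≤ (All.map⁺ (All.map (λ {𝕏} → ∣∣-mono 𝕏 𝕌)
      (nameSets-⊆ ω 𝕌 (tree π) (All.map⁻ (⊆-⋃ (map names (cpts (tree π))))))))
      where 𝕌 = ⋃ (map names (cpts (tree π)))

    cost≤ : cost π ≤ 3 * (#axioms π * 2 ^ width π)
    cost≤ = begin
      -- The potential of the conclusion is discarded.
      cost π                          ≤⟨ m≤m+n _ _ ⟩
      amortised ω (width π) (decorate (tree π))
        ≤⟨ amortised-decorate ω (width π) (tree π) (All.map⁻ (≤maximum _)) ⟩
      #axioms π * (3 * 2 ^ width π)   ≡⟨ swap (#axioms π) (2 ^ width π) ⟩
      3 * (#axioms π * 2 ^ width π)   ∎
      where
      open ≤-Reasoning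
      swap : ∀ m b → m * (3 * b) ≡ 3 * (m * b)
      swap = solve-∀

proposition9p3 : ∀ {c ℓ} (R : CommutativeSemiring c ℓ) → let open Calculus R in
    ∃ λ (C : ℕ) →
    ∀ {n : ℕ} {Λ : Ctx n} {t : Term n} {L : Ground} → IsGround Λ →
    (π : Derivation Λ t (pos (ground L))) →
    (width π ≤ #names π) × (cost π ≤ C * (#axioms π * 2 ^ width π))
-- The constant is one `2 ^ width π` for the entries of the table of an axiom and two for its
-- reserve.
proposition9p3 R = 3 , λ _ π → width≤#names R π , cost≤ R π
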